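{- Let $\mathbf{Sober}$ be the category of sober semitopologies with continuous maps, and $\mathbf{Spatial}$ the category of spatial semiframes with semiframe morphisms. Define $\mathrm{Fr}(\mathsf P,\mathcal O)=(\mathcal O,\subseteq,\between)$ and, for a continuous $f$, $\mathrm{Fr}(f)=f^{ -1}$; define $\mathrm{St}$ on objects as below and, for a semiframe morphism $g:(X',\le',\ast')\to(X,\le,\ast)$, $\mathrm{St}(g)=g^\circ:\mathrm{Points}(X,\le,\ast)\to\mathrm{Points}(X',\le',\ast')$, $g^\circ(F)=\{x'\in X'\mid g(x')\in F\}$. Then $\mathrm{Fr}:\mathbf{Sober}\to\mathbf{Spatial}^{op}$ and $\mathrm{St}:\mathbf{Spatial}^{op}\to\mathbf{Sober}$ are well-defined functors forming an equivalence of categories (a duality between $\mathbf{Sober}$ and $\mathbf{Spatial}$), with natural isomorphisms $\mathrm{nbhd}:(\mathsf P,\mathcal O)\to\mathrm{St}\,\mathrm{Fr}(\mathsf P,\mathcal O)$, $p\mapsto\{O\in\mathcal O\mid p\in O\}$, and $\mathrm{Op}:(X,\le,\ast)\to\mathrm{Fr}\,\mathrm{St}(X,\le,\ast)$, $x\mapsto\mathrm{Op}(x)$.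
   Context: A semitopology is a set $\mathsf P$ with $\mathcal O\subseteq\mathcal P(\mathsf P)$ containing $\varnothing,\mathsf P$ and closed under arbitrary unions; morphisms are continuous maps (preimages of opens are open). A semiframe is a complete join-semilattice $(X,\le)$ (with $\bot_X=\bigvee\varnothing$, $\top_X=\bigvee X$) with a relation $\ast$ that is commutative, satisfies $x\ast x$ for $x\neq\bot_X$, and $x\ast\bigvee Y$ iff $x\ast y$ for some $y\in Y$; $(\mathcal O,\subseteq,\between)$, where $O\between O'$ iff $O\cap O'\ne\varnothing$, is a semiframe. A semiframe morphism $g:(X',\le',\ast')\to(X,\le,\ast)$ is a map preserving all joins and the top element ($g(\top_{X'})=\top_X$) such that $g(x')\ast g(x'')$ implies $x'\ast' x''$. An abstract point is a nonempty, up-closed, pairwise $\ast$-compatible subset $F$ that is completely prime ($\bigvee Y\in F$ implies some $y\in Y$ lies in $F$, for all $Y$ including $\varnothing$); $\mathrm{Points}(X,\le,\ast)$ is the set of abstract points; $\mathrm{Op}(x)$ is the set of abstract points containing $x$; $\mathrm{St}(X,\le,\ast)$ is the semitopology with points $\mathrm{Points}(X,\le,\ast)$ and opens $\{\mathrm{Op}(x)\mid x\in X\}$. A semiframe is spatial when $\mathrm{Op}(x)\subseteq\mathrm{Op}(x')$ implies $x\le x'$, and $x\ast x'$ implies $\mathrm{Op}(x)\cap\mathrm{Op}(x')\ne\varnothing$. A semitopology is sober when $\mathrm{nbhd}$ is a bijection from $\mathsf P$ onto $\mathrm{Points}(\mathcal O,\subseteq,\between)$. -}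

module Defs where

open import Axiom.ExcludedMiddle using (ExcludedMiddle)
open import Data.Bool using (Bool; true; false; T)
open import Data.Empty using (⊥-elim)
open import Data.Product using (Σ; Σ-syntax; ∃-syntax; _×_; _,_; proj₁; proj₂)
open import Function.Base using (_on_; const)
open import Function.Bundles using (Func; _⇔_; mk⇔)
open import Function.Definitions using (Bijective)
import Function.Construct.Composition as Comp
import Function.Construct.Identity as Ident
open import Function.Relation.Binary.Setoid.Equality using (_⇨_)
open import Level using (Level; _⊔_) renaming (suc to lsuc)
open import Relation.Binary.Bundles using (Setoid; Poset)
open import Relation.Binary.Core using (Rel)
open import Relation.Binary.Definitions using (Symmetric; _Respects_; _Respects₂_)
open import Relation.Binary.Structures using (IsEquivalence)
import Relation.Binary.Construct.On as On
open import Relation.Binary.PropositionalEquality as ≡ using (_≡_)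
open import Relation.Nullary using (¬_; yes; no; isYes; toWitness; fromWitness)

open Func using (to; cong)

record Category (o m e : Level) : Set (lsuc (o ⊔ m ⊔ e)) where
  infix  4 _≈_
  infixr 9 _∘_
  field
    Obj       : Set o
    _⇒_       : Obj → Obj → Set m
    _≈_       : ∀ {A B} → Rel (A ⇒ B) e
    id        : ∀ {A} → A ⇒ A
    _∘_       : ∀ {A B C} → B ⇒ C → A ⇒ B → A ⇒ C
    equiv     : ∀ {A B} → IsEquivalence (_≈_ {A} {B})
    ∘-resp-≈  : ∀ {A B C} {f h : B ⇒ C} {g i : A ⇒ B} → f ≈ h → g ≈ i → f ∘ g ≈ h ∘ i
    assoc     : ∀ {A B C D} {f : A ⇒ B} {g : B ⇒ C} {h : C ⇒ D} → (h ∘ g) ∘ f ≈ h ∘ (g ∘ f)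
    identityˡ : ∀ {A B} {f : A ⇒ B} → id ∘ f ≈ f
    identityʳ : ∀ {A B} {f : A ⇒ B} → f ∘ id ≈ f

_ᵒᵖ : ∀ {o m e} → Category o m e → Category o m e
C ᵒᵖ = record
  { Obj       = Obj
  ; _⇒_       = λ A B → B ⇒ A
  ; _≈_       = _≈_
  ; id        = id
  ; _∘_       = λ f g → g ∘ f
  ; equiv     = equiv
  ; ∘-resp-≈  = λ p q → ∘-resp-≈ q p
  ; assoc     = IsEquivalence.sym equiv assoc
  ; identityˡ = identityʳ
  ; identityʳ = identityˡ
  }
  where open Category C

module _ {o m e o′ m′ e′ : Level} where

  -- The object map is a parameter so that a functor can be required to have a
  -- prescribed action on objects without equations between objects.
  record Functor (C : Category o m e) (D : Category o′ m′ e′)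
                 (F₀ : Category.Obj C → Category.Obj D) : Set (o ⊔ m ⊔ e ⊔ m′ ⊔ e′) where
    private
      module C = Category C
      module D = Category D
    field
      F₁           : ∀ {A B} → A C.⇒ B → F₀ A D.⇒ F₀ B
      F-resp-≈     : ∀ {A B} {f g : A C.⇒ B} → f C.≈ g → F₁ f D.≈ F₁ g
      identity     : ∀ {A} → F₁ (C.id {A}) D.≈ D.id
      homomorphism : ∀ {X Y Z} {f : X C.⇒ Y} {g : Y C.⇒ Z} → F₁ (g C.∘ f) D.≈ F₁ g D.∘ F₁ f

  record NaturalIsomorphism {C : Category o m e} {D : Category o′ m′ e′}
                            {F₀ G₀ : Category.Obj C → Category.Obj D}
                            (F : Functor C D F₀) (G : Functor C D G₀)
                            : Set (o ⊔ m ⊔ m′ ⊔ e′) where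
    private
      module C = Category C
      module D = Category D
      module F = Functor F
      module G = Functor G
    field
      component : ∀ A → F₀ A D.⇒ G₀ A
      inverse   : ∀ A → G₀ A D.⇒ F₀ A
      isoˡ      : ∀ A → inverse A D.∘ component A D.≈ D.id
      isoʳ      : ∀ A → component A D.∘ inverse A D.≈ D.id
      natural   : ∀ {A B} (f : A C.⇒ B) → component B D.∘ F.F₁ f D.≈ G.F₁ f D.∘ component A

idF : ∀ {o m e} {C : Category o m e} → Functor C C (λ A → A)
idF {C = C} = record
  { F₁           = λ f → f
  ; F-resp-≈     = λ p → p
  ; identity     = IsEquivalence.refl equiv
  ; homomorphism = IsEquivalence.refl equiv
  }
  where open Category C

infixr 9 _∘F_
_∘F_ : ∀ {o m e o′ m′ e′ o″ m″ e″}
       {C : Category o m e} {D : Category o′ m′ e′} {E : Category o″ m″ e″} {F₀ G₀} →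
       Functor D E G₀ → Functor C D F₀ → Functor C E (λ A → G₀ (F₀ A))
_∘F_ {E = E} G F = record
  { F₁           = λ f → G.F₁ (F.F₁ f)
  ; F-resp-≈     = λ p → G.F-resp-≈ (F.F-resp-≈ p)
  ; identity     = IsEquivalence.trans equiv (G.F-resp-≈ F.identity) G.identity
  ; homomorphism = IsEquivalence.trans equiv (G.F-resp-≈ F.homomorphism) G.homomorphism
  }
  where
  open Category E
  module F = Functor F
  module G = Functor G

record CategoryEquivalence {o m e o′ m′ e′} {C : Category o m e} {D : Category o′ m′ e′} {F₀ G₀}
                           (F : Functor C D F₀) (G : Functor D C G₀)
                           : Set (o ⊔ m ⊔ e ⊔ o′ ⊔ m′ ⊔ e′) where
  field
    unit   : NaturalIsomorphism idF (G ∘F F)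
    counit : NaturalIsomorphism (F ∘F G) idF

-- Sets are setoids, and the powerset consists of the Bool-valued
-- characteristic functions that respect the equality.  Under excluded middle
-- these are all the subsets, and the powerset stays in the same universe.

module _ {a : Level} where

  𝒫 : Setoid a a → Setoid a a
  𝒫 A = A ⇨ ≡.setoid Bool

  Subset : Setoid a a → Set a
  Subset A = Setoid.Carrier (𝒫 A)

  infix 4 _∈_ _⊆_ _≐_
  _∈_ : {A : Setoid a a} → Setoid.Carrier A → Subset A → Set
  x ∈ U = T (to U x)

  _⊆_ : {A : Setoid a a} → Rel (Subset A) a
  U ⊆ V = ∀ x → x ∈ U → x ∈ V

  _≐_ : {A : Setoid a a} → Rel (Subset A) a
  _≐_ {A} = Setoid._≈_ (𝒫 A)

  ∅ full : (A : Setoid a a) → Subset A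
  ∅    A = record { to = const false ; cong = λ _ → ≡.refl }
  full A = record { to = const true  ; cong = λ _ → ≡.refl }

  preimage : {A B : Setoid a a} → Func A B → Subset B → Subset A
  preimage f V = Comp.function f V

  ∈-resp : {A : Setoid a a} (U : Subset A) → (_∈ U) Respects (Setoid._≈_ A)
  ∈-resp U x≈y = ≡.subst T (cong U x≈y)

  ≐⇒⊆ : {A : Setoid a a} {U V : Subset A} → U ≐ V → U ⊆ V
  ≐⇒⊆ U≐V x = ≡.subst T (U≐V x)

  ≐-sym : {A : Setoid a a} {U V : Subset A} → U ≐ V → V ≐ U
  ≐-sym U≐V x = ≡.sym (U≐V x)

  ≐-trans : {A : Setoid a a} {U V W : Subset A} → U ≐ V → V ≐ W → U ≐ W
  ≐-trans p q x = ≡.trans (p x) (q x)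

T-ext : ∀ {b c} → (T b → T c) → (T c → T b) → b ≡ c
T-ext {false} {false} f g = ≡.refl
T-ext {false} {true}  f g = ⊥-elim (g _)
T-ext {true}  {false} f g = ⊥-elim (f _)
T-ext {true}  {true}  f g = ≡.refl

⊆-antisym : ∀ {a} {A : Setoid a a} {U V : Subset A} → U ⊆ V → V ⊆ U → U ≐ V
⊆-antisym p q x = T-ext (p x) (q x)

-- Excluded middle is needed for (𝒪 , ⊆ , ≬) to satisfy x ∗ x for all x ≠ ⊥, and
-- to turn a property into a Bool-valued subset.
module Semi {ℓ : Level} (lem : ExcludedMiddle ℓ) where

  -- {x ∈ A | φ x}
  compr : (A : Setoid ℓ ℓ) (φ : Setoid.Carrier A → Set ℓ) → φ Respects (Setoid._≈_ A) → Subset A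
  compr A φ resp = record
    { to   = λ x → isYes (lem {φ x})
    ; cong = λ {x} {y} x≈y → T-ext
        (λ t → fromWitness (resp x≈y (toWitness t)))
        (λ t → fromWitness (resp (Setoid.sym A x≈y) (toWitness t)))
    }

  image : {A B : Setoid ℓ ℓ} → Func A B → Subset A → Subset B
  image {A} {B} f U = compr B (λ y → ∃[ x ] (x ∈ U × y B.≈ to f x))
    (λ y≈z (x , x∈U , y≈fx) → x , x∈U , B.trans (B.sym y≈z) y≈fx)
    where module B = Setoid B

  ⋃ : {A : Setoid ℓ ℓ} → Subset (𝒫 A) → Subset A
  ⋃ {A} 𝒴 = compr A (λ x → ∃[ U ] (U ∈ 𝒴 × x ∈ U))
    (λ x≈y (U , U∈𝒴 , x∈U) → U , U∈𝒴 , ∈-resp U x≈y x∈U)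

  record Semitopology : Set (lsuc ℓ) where
    field
      points : Setoid ℓ ℓ
      𝒪      : Subset (𝒫 points)
      ∅∈𝒪    : ∅ points ∈ 𝒪
      full∈𝒪 : full points ∈ 𝒪
      ⋃∈𝒪    : ∀ 𝒴 → 𝒴 ⊆ 𝒪 → ⋃ 𝒴 ∈ 𝒪

    Open : Set ℓ
    Open = Σ[ O ∈ Subset points ] O ∈ 𝒪

  open Semitopology using (points; 𝒪; Open)

  record Semiframe : Set (lsuc ℓ) where
    infix 4 _∗_
    field
      poset : Poset ℓ ℓ ℓ
    open Poset poset public
    setoid : Setoid ℓ ℓ
    setoid = Eq.setoid
    field
      ⋁       : Subset setoid → Carrier
      ⋁-upper : ∀ Y y → y ∈ Y → y ≤ ⋁ Y
      ⋁-least : ∀ Y z → (∀ y → y ∈ Y → y ≤ z) → ⋁ Y ≤ z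
      _∗_     : Rel Carrier ℓ
      ∗-resp  : _∗_ Respects₂ _≈_
    ⊥ₓ : Carrier
    ⊥ₓ = ⋁ (∅ setoid)
    ⊤ₓ : Carrier
    ⊤ₓ = ⋁ (full setoid)
    field
      ∗-comm : Symmetric _∗_
      ∗-refl : ∀ x → ¬ (x ≈ ⊥ₓ) → x ∗ x
      ∗-⋁    : ∀ x Y → (x ∗ ⋁ Y) ⇔ (∃[ y ] (y ∈ Y × x ∗ y))

  record ContinuousMap (S S′ : Semitopology) : Set ℓ where
    field
      map        : Func (points S) (points S′)
      continuous : ∀ O → O ∈ 𝒪 S′ → preimage map O ∈ 𝒪 S

  record SemiframeMorphism (X′ X : Semiframe) : Set ℓ where
    private
      module X′ = Semiframe X′
      module X  = Semiframe X
    field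
      map         : Func X′.setoid X.setoid
      preserves-⋁ : ∀ Y → to map (X′.⋁ Y) X.≈ X.⋁ (image map Y)
      preserves-⊤ : to map X′.⊤ₓ X.≈ X.⊤ₓ
      reflects-∗  : ∀ x y → to map x X.∗ to map y → x X′.∗ y

  record IsAbstractPoint (X : Semiframe) (F : Subset (Semiframe.setoid X)) : Set ℓ where
    open Semiframe X
    field
      nonempty         : ∃[ x ] x ∈ F
      up-closed        : ∀ x y → x ∈ F → x ≤ y → y ∈ F
      compatible       : ∀ x y → x ∈ F → y ∈ F → x ∗ y
      completely-prime : ∀ Y → ⋁ Y ∈ F → ∃[ y ] (y ∈ Y × y ∈ F)

  Points : Semiframe → Setoid ℓ ℓ
  Points X = record
    { Carrier       = Σ (Subset (Semiframe.setoid X)) (IsAbstractPoint X)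
    ; _≈_           = _≐_ on proj₁
    ; isEquivalence = On.isEquivalence proj₁ (Setoid.isEquivalence (𝒫 (Semiframe.setoid X)))
    }

  Op : (X : Semiframe) → Semiframe.Carrier X → Subset (Points X)
  Op X x = record { to = λ F → to (proj₁ F) x ; cong = λ F≈G → F≈G x }

  St₀ : Semiframe → Semitopology
  St₀ X = record
    { points = Points X
    ; 𝒪      = opens
    ; ∅∈𝒪    = fromWitness (⊥ₓ , ⊆-antisym {U = ∅ (Points X)} {V = Op X ⊥ₓ} (λ _ ())
        λ (F , pt) ⊥∈F → proj₁ (proj₂ (IsAbstractPoint.completely-prime pt _ ⊥∈F)))
    ; full∈𝒪 = fromWitness (⊤ₓ , ⊆-antisym {U = full (Points X)} {V = Op X ⊤ₓ}
        (λ (F , pt) _ → let (x , x∈F) = IsAbstractPoint.nonempty pt in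
           IsAbstractPoint.up-closed pt x ⊤ₓ x∈F (⋁-upper (full setoid) x _))
        (λ _ _ → _))
    ; ⋃∈𝒪    = λ 𝒴 𝒴⊆𝒪 → fromWitness (⋁ (indices 𝒴) ,
        ⊆-antisym {U = ⋃ 𝒴} {V = Op X (⋁ (indices 𝒴))} (to-⋁ 𝒴 𝒴⊆𝒪) (from-⋁ 𝒴))
    }
    where
    open Semiframe X

    opens : Subset (𝒫 (Points X))
    opens = compr (𝒫 (Points X)) (λ U → ∃[ x ] U ≐ Op X x)
      (λ {U} {V} U≐V (x , U≐x) →
         x , ≐-trans {U = V} {V = U} {W = Op X x} (≐-sym {U = U} {V = V} U≐V) U≐x)

    Op-cong : ∀ {x y} → x ≈ y → Op X x ≐ Op X y
    Op-cong x≈y (F , _) = cong F x≈y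

    indices : Subset (𝒫 (Points X)) → Subset setoid
    indices 𝒴 = record { to = λ x → to 𝒴 (Op X x) ; cong = λ x≈y → cong 𝒴 (Op-cong x≈y) }

    to-⋁ : ∀ 𝒴 → 𝒴 ⊆ opens → ⋃ 𝒴 ⊆ Op X (⋁ (indices 𝒴))
    to-⋁ 𝒴 𝒴⊆𝒪 (F , pt) F∈⋃ =
      let (U , U∈𝒴 , F∈U) = toWitness F∈⋃
          (x , U≐x)       = toWitness (𝒴⊆𝒪 U U∈𝒴)
      in IsAbstractPoint.up-closed pt x (⋁ (indices 𝒴))
           (≐⇒⊆ {U = U} {V = Op X x} U≐x (F , pt) F∈U)
           (⋁-upper (indices 𝒴) x (∈-resp 𝒴 {U} {Op X x} U≐x U∈𝒴))

    from-⋁ : ∀ 𝒴 → Op X (⋁ (indices 𝒴)) ⊆ ⋃ 𝒴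
    from-⋁ 𝒴 (F , pt) ⋁∈F =
      let (x , x∈I , x∈F) = IsAbstractPoint.completely-prime pt (indices 𝒴) ⋁∈F
      in fromWitness (Op X x , x∈I , x∈F)

  Fr₀ : Semitopology → Semiframe
  Fr₀ S = record
    { poset   = record
        { Carrier = Open S
        ; _≈_     = _≐_ on proj₁
        ; _≤_     = _⊆_ on proj₁
        ; isPartialOrder = record
            { isPreorder = record
                { isEquivalence = On.isEquivalence proj₁ (Setoid.isEquivalence (𝒫 (points S)))
                ; reflexive     = λ {O} {O′} → ≐⇒⊆ {U = proj₁ O} {V = proj₁ O′}
                ; trans         = λ p q x x∈O → q x (p x x∈O)
                }
            ; antisym = λ {O} {O′} → ⊆-antisym {U = proj₁ O} {V = proj₁ O′}
            }
        }
    ; ⋁       = join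
    ; ⋁-upper = λ Y O O∈Y p p∈O → fromWitness (proj₁ O , fromWitness (O , O∈Y , λ _ → ≡.refl) , p∈O)
    ; ⋁-least = λ Y Z ub p p∈⋁ → let (O , O∈Y , p∈O) = from-join Y p p∈⋁ in ub O O∈Y p p∈O
    ; _∗_     = λ O O′ → ∃[ p ] (p ∈ proj₁ O × p ∈ proj₁ O′)
    ; ∗-resp  = (λ e (p , a , b) → p , a , ≡.subst T (e p) b)
              , (λ e (p , a , b) → p , ≡.subst T (e p) a , b)
    ; ∗-comm  = λ (p , a , b) → p , b , a
    ; ∗-refl  = inhabited
    ; ∗-⋁     = λ O Y → mk⇔
        (λ (p , p∈O , p∈⋁) → let (O′ , O′∈Y , p∈O′) = from-join Y p p∈⋁ in O′ , O′∈Y , p , p∈O , p∈O′)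
        (λ (O′ , O′∈Y , p , p∈O , p∈O′) →
           p , p∈O , fromWitness (proj₁ O′ , fromWitness (O′ , O′∈Y , λ _ → ≡.refl) , p∈O′))
    }
    where
    opens : Setoid ℓ ℓ
    opens = record
      { Carrier       = Open S
      ; _≈_           = _≐_ on proj₁
      ; isEquivalence = On.isEquivalence proj₁ (Setoid.isEquivalence (𝒫 (points S)))
      }

    underlying : Func opens (𝒫 (points S))
    underlying = record { to = proj₁ ; cong = λ e → e }

    join : Subset opens → Open S
    join Y = ⋃ (image underlying Y) , Semitopology.⋃∈𝒪 S (image underlying Y) λ U U∈ →
      let ((O , O∈𝒪) , _ , U≐O) = toWitness U∈
      in ∈-resp (𝒪 S) {O} {U} (≐-sym {U = U} {V = O} U≐O) O∈𝒪

    from-join : ∀ Y p → p ∈ proj₁ (join Y) → ∃[ O ] (O ∈ Y × p ∈ proj₁ O)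
    from-join Y p p∈⋁ =
      let (U , U∈ , p∈U)    = toWitness p∈⋁
          (O , O∈Y , U≐O) = toWitness U∈
      in O , O∈Y , ≐⇒⊆ {U = U} {V = proj₁ O} U≐O p p∈U

    inhabited : ∀ O → ¬ (proj₁ O ≐ proj₁ (join (∅ opens))) → ∃[ p ] (p ∈ proj₁ O × p ∈ proj₁ O)
    inhabited O O≢⊥ with lem {∃[ p ] (p ∈ proj₁ O × p ∈ proj₁ O)}
    ... | yes w = w
    ... | no ¬w = ⊥-elim (O≢⊥ (⊆-antisym {U = proj₁ O} {V = proj₁ (join (∅ opens))}
                    (λ p p∈O → ⊥-elim (¬w (p , p∈O , p∈O)))
                    (λ p p∈⊥ → ⊥-elim (proj₁ (proj₂ (from-join (∅ opens) p p∈⊥))))))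

  nbhd : (S : Semitopology) → Setoid.Carrier (points S) → Setoid.Carrier (Points (Fr₀ S))
  nbhd S p = record { to = λ O → to (proj₁ O) p ; cong = λ e → e p } , record
    { nonempty         = (full (points S) , Semitopology.full∈𝒪 S) , _
    ; up-closed        = λ O O′ p∈O O⊆O′ → O⊆O′ p p∈O
    ; compatible       = λ O O′ p∈O p∈O′ → p , p∈O , p∈O′
    ; completely-prime = λ Y p∈⋁ →
        let (U , U∈ , p∈U)  = toWitness p∈⋁
            (O , O∈Y , U≐O) = toWitness U∈
        in O , O∈Y , ≐⇒⊆ {U = U} {V = proj₁ O} U≐O p p∈U
    }

  IsSober : Semitopology → Set ℓ
  IsSober S = Bijective (Setoid._≈_ (points S)) (Setoid._≈_ (Points (Fr₀ S))) (nbhd S)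

  record IsSpatial (X : Semiframe) : Set ℓ where
    open Semiframe X
    field
      reflects-≤ : ∀ x y → Op X x ⊆ Op X y → x ≤ y
      ∗⇒≬        : ∀ x y → x ∗ y → ∃[ F ] (F ∈ Op X x × F ∈ Op X y)

  idᶜ : ∀ {S} → ContinuousMap S S
  idᶜ {S} = record { map = Ident.function (points S) ; continuous = λ O O∈ → O∈ }

  infixr 9 _∘ᶜ_ _∘ˢ_
  _∘ᶜ_ : ∀ {S S′ S″} → ContinuousMap S′ S″ → ContinuousMap S S′ → ContinuousMap S S″
  f ∘ᶜ g = record
    { map        = Comp.function g.map f.map
    ; continuous = λ O O∈ → g.continuous (preimage f.map O) (f.continuous O O∈)
    }
    where
    module f = ContinuousMap f
    module g = ContinuousMap g

  module _ (X : Semiframe) where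
    open Semiframe X

    ⋁-mono : ∀ Y Z → (∀ y → y ∈ Y → ∃[ z ] (z ∈ Z × y ≤ z)) → ⋁ Y ≤ ⋁ Z
    ⋁-mono Y Z h = ⋁-least Y (⋁ Z) λ y y∈Y →
      let (z , z∈Z , y≤z) = h y y∈Y in trans y≤z (⋁-upper Z z z∈Z)

  idˢ : ∀ {X} → SemiframeMorphism X X
  idˢ {X} = record
    { map         = Ident.function setoid
    ; preserves-⋁ = λ Y → antisym
        (⋁-mono X Y (image (Ident.function setoid) Y) λ y y∈Y → y , fromWitness (y , y∈Y , Eq.refl) , refl)
        (⋁-mono X (image (Ident.function setoid) Y) Y λ y y∈ → let (z , z∈Y , y≈z) = toWitness y∈ in z , z∈Y , reflexive y≈z)
    ; preserves-⊤ = Eq.refl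
    ; reflects-∗  = λ _ _ x∗y → x∗y
    }
    where open Semiframe X

  _∘ˢ_ : ∀ {X X′ X″} → SemiframeMorphism X′ X″ → SemiframeMorphism X X′ → SemiframeMorphism X X″
  _∘ˢ_ {X′ = X′} {X″} f g = record
    { map         = Comp.function g.map f.map
    ; preserves-⋁ = λ Y → Eq.trans (cong f.map (g.preserves-⋁ Y)) (Eq.trans (f.preserves-⋁ (image g.map Y)) (antisym
        (⋁-mono X″ (image f.map (image g.map Y)) (image (Comp.function g.map f.map) Y) λ z z∈ →
           let (y , y∈ , z≈fy)  = toWitness z∈
               (x , x∈Y , y≈gx) = toWitness y∈
           in z , fromWitness (x , x∈Y , Eq.trans z≈fy (cong f.map y≈gx)) , refl)
        (⋁-mono X″ (image (Comp.function g.map f.map) Y) (image f.map (image g.map Y)) λ z z∈ →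
           let (x , x∈Y , z≈fgx) = toWitness z∈
           in z , fromWitness (to g.map x , fromWitness (x , x∈Y , Semiframe.Eq.refl X′) , z≈fgx) , refl)))
    ; preserves-⊤ = Eq.trans (cong f.map g.preserves-⊤) f.preserves-⊤
    ; reflects-∗  = λ x y p → g.reflects-∗ x y (f.reflects-∗ _ _ p)
    }
    where
    open Semiframe X″
    module f = SemiframeMorphism f
    module g = SemiframeMorphism g

  Sober : Category (lsuc ℓ) ℓ ℓ
  Sober = record
    { Obj       = Σ Semitopology IsSober
    ; _⇒_       = λ (S , _) (S′ , _) → ContinuousMap S S′
    ; _≈_       = λ {(S , _)} {(S′ , _)} → Setoid._≈_ (points S ⇨ points S′) on ContinuousMap.map
    ; id        = idᶜ
    ; _∘_       = _∘ᶜ_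
    ; equiv     = λ {(S , _)} {(S′ , _)} →
        On.isEquivalence ContinuousMap.map (Setoid.isEquivalence (points S ⇨ points S′))
    ; ∘-resp-≈  = λ {_} {_} {(S″ , _)} {f} {h} {g} {i} f≈h g≈i x →
        Setoid.trans (points S″) (f≈h _) (cong (ContinuousMap.map h) (g≈i x))
    ; assoc     = λ {_} {_} {_} {(S , _)} _ → Setoid.refl (points S)
    ; identityˡ = λ {_} {(S , _)} _ → Setoid.refl (points S)
    ; identityʳ = λ {_} {(S , _)} _ → Setoid.refl (points S)
    }

  Spatial : Category (lsuc ℓ) ℓ ℓ
  Spatial = record
    { Obj       = Σ Semiframe IsSpatial
    ; _⇒_       = λ (X , _) (X′ , _) → SemiframeMorphism X X′
    ; _≈_       = λ {(X , _)} {(X′ , _)} →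
        Setoid._≈_ (Semiframe.setoid X ⇨ Semiframe.setoid X′) on SemiframeMorphism.map
    ; id        = idˢ
    ; _∘_       = _∘ˢ_
    ; equiv     = λ {(X , _)} {(X′ , _)} →
        On.isEquivalence SemiframeMorphism.map
          (Setoid.isEquivalence (Semiframe.setoid X ⇨ Semiframe.setoid X′))
    ; ∘-resp-≈  = λ {_} {_} {(X″ , _)} {f} {h} {g} {i} f≈h g≈i x →
        Semiframe.Eq.trans X″ (f≈h _) (cong (SemiframeMorphism.map h) (g≈i x))
    ; assoc     = λ {_} {_} {_} {(X , _)} _ → Semiframe.Eq.refl X
    ; identityˡ = λ {_} {(X , _)} _ → Semiframe.Eq.refl X
    ; identityʳ = λ {_} {(X , _)} _ → Semiframe.Eq.refl X
    }

{-# OPTIONS --safe #-}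
module Submission where

open import Defs
open import Axiom.ExcludedMiddle using (ExcludedMiddle)
open import Data.Bool using (T)
open import Data.Product using (Σ; Σ-syntax; ∃-syntax; _×_; _,_; proj₁; proj₂)
open import Function.Bundles using (Func)
open import Level using (Level)
open import Relation.Binary.Bundles using (Setoid)
open import Relation.Binary.PropositionalEquality using (refl; sym; trans; subst)
open import Relation.Nullary using (toWitness; fromWitness)

-- The opens of St X are exactly the sets Op x, so a point 𝔽 of Fr (St X) is
-- the neighbourhood filter of {x | Op x ∈ 𝔽}, which is compatible because
-- intersecting opens Op x, Op y share an abstract point.  Dually, x ↦ Op x is
-- onto the opens by construction, and spatiality says precisely that it
-- reflects ≤ and preserves ∗, hence that its inverse is a semiframe morphism.

module _ {ℓ : Level} (lem : ExcludedMiddle ℓ) where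
  open Semi lem
  open Func using (to; cong)
  open Semitopology using (points; 𝒪; Open)

  -- The semiframe of opens: spatiality and the action of `Fr` on continuous maps.

  ∈⋁⇒∈some : ∀ S Y p → p ∈ proj₁ (Semiframe.⋁ (Fr₀ S) Y) → ∃[ O ] (O ∈ Y × p ∈ proj₁ O)
  ∈⋁⇒∈some S Y p = IsAbstractPoint.completely-prime (proj₂ (nbhd S p)) Y

  -- Neighbourhood filters supply enough abstract points: testing at every `nbhd S p` recovers
  -- inclusion, and a point `p` shared by two opens yields the shared abstract point `nbhd S p`.
  Fr-spatial : ∀ S → IsSpatial (Fr₀ S)
  Fr-spatial S = record
    { reflects-≤ = λ _ _ O⊆O′ p → O⊆O′ (nbhd S p)
    ; ∗⇒≬        = λ _ _ (p , p∈O , p∈O′) → nbhd S p , p∈O , p∈O′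
    }

  Fr₁ : ∀ {S S′} → ContinuousMap S S′ → SemiframeMorphism (Fr₀ S′) (Fr₀ S)
  Fr₁ {S} {S′} f = record
    { map         = f⁻¹
    ; preserves-⋁ = λ Y → ⊆-antisym
        {U = proj₁ (to f⁻¹ (S′.⋁ Y))} {V = proj₁ (S.⋁ (image f⁻¹ Y))}
        (λ p fp∈⋁ → let (O , O∈Y , fp∈O) = ∈⋁⇒∈some S′ Y (to f.map p) fp∈⋁ in
           S.⋁-upper (image f⁻¹ Y) (to f⁻¹ O) (fromWitness (O , O∈Y , λ _ → refl)) p fp∈O)
        (λ p p∈⋁ →
           let (U , U∈ , p∈U)    = ∈⋁⇒∈some S (image f⁻¹ Y) p p∈⋁
               (O , O∈Y , U≐f⁻¹O) = toWitness U∈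
           in S′.⋁-upper Y O O∈Y (to f.map p) (subst T (U≐f⁻¹O p) p∈U))
    -- `⊤ₓ` is the join of all opens rather than `full` itself, so membership of `to f.map p` in
    -- `S′.⊤ₓ` goes through the open `full`.
    ; preserves-⊤ = ⊆-antisym {U = proj₁ (to f⁻¹ S′.⊤ₓ)} {V = proj₁ S.⊤ₓ}
        (S.⋁-upper (full S.setoid) (to f⁻¹ S′.⊤ₓ) _)
        (λ p _ → S′.⋁-upper (full S′.setoid) (full (points S′) , Semitopology.full∈𝒪 S′) _ (to f.map p) _)
    ; reflects-∗  = λ _ _ (p , fp∈O , fp∈O′) → to f.map p , fp∈O , fp∈O′
    }
    where
    module f = ContinuousMap f
    module S = Semiframe (Fr₀ S)
    module S′ = Semiframe (Fr₀ S′)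
    f⁻¹ : Func S′.setoid S.setoid
    f⁻¹ = record
      { to   = λ (O , O∈𝒪) → preimage f.map O , f.continuous O O∈𝒪
      ; cong = λ O≐O′ p → O≐O′ (to f.map p)
      }

  -- The map `Op`, its inverse in the spatial case, and sobriety of `St X`.

  module _ (X : Semiframe) where
    open Semiframe X using (setoid; Carrier; ⋁; ⋁-upper)
    private module StX = Semiframe (Fr₀ (St₀ X))

    Op-open : Carrier → Open (St₀ X)
    Op-open x = Op X x , fromWitness (x , λ _ → refl)

    Op-func : Func setoid StX.setoid
    Op-func = record { to = Op-open ; cong = λ x≈y (F , _) → cong F x≈y }

    -- One inclusion is complete primeness of abstract points, the other their up-closure.
    Op-preserves-⋁ : ∀ Y → Op X (⋁ Y) ≐ proj₁ (StX.⋁ (image Op-func Y))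
    Op-preserves-⋁ Y = ⊆-antisym {U = Op X (⋁ Y)} {V = proj₁ (StX.⋁ (image Op-func Y))}
      (λ F@(_ , pt) ⋁∈F →
         let (y , y∈Y , y∈F) = IsAbstractPoint.completely-prime pt Y ⋁∈F in
         StX.⋁-upper (image Op-func Y) (Op-open y) (fromWitness (y , y∈Y , λ _ → refl)) F y∈F)
      (λ F@(_ , pt) F∈⋁ →
         let (U , U∈ , F∈U)     = ∈⋁⇒∈some (St₀ X) (image Op-func Y) F F∈⋁
             (y , y∈Y , U≐Opy) = toWitness U∈
         in IsAbstractPoint.up-closed pt y (⋁ Y) (subst T (U≐Opy F) F∈U) (⋁-upper Y y y∈Y))

    Op-preserves-⊤ : Op X (Semiframe.⊤ₓ X) ≐ proj₁ StX.⊤ₓ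
    Op-preserves-⊤ = ⊆-antisym {U = Op X (Semiframe.⊤ₓ X)} {V = proj₁ StX.⊤ₓ}
      (StX.⋁-upper (full StX.setoid) (Op-open (Semiframe.⊤ₓ X)) _)
      (λ (_ , pt) _ → let (x , x∈F) = IsAbstractPoint.nonempty pt in
         IsAbstractPoint.up-closed pt x _ x∈F (⋁-upper (full setoid) x _))

    Op-morphism : SemiframeMorphism X (Fr₀ (St₀ X))
    Op-morphism = record
      { map         = Op-func
      ; preserves-⋁ = Op-preserves-⋁
      ; preserves-⊤ = Op-preserves-⊤
      ; reflects-∗  = λ x y ((_ , pt) , x∈F , y∈F) → IsAbstractPoint.compatible pt x y x∈F y∈F
      }

    -- The index is whatever `lem` delivered, and nothing forces equal opens to receive equal
    -- indices. Only injectivity of `Op`, hence spatiality, turns this choice into the setoid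
    -- function `Op⁻¹`.
    index : (U : Open (St₀ X)) → ∃[ x ] proj₁ U ≐ Op X x
    index (_ , U∈𝒪) = toWitness U∈𝒪

    module _ (spatial : IsSpatial X) where
      open IsSpatial spatial

      Op-injective : ∀ {x y} → Op X x ≐ Op X y → Semiframe._≈_ X x y
      Op-injective {x} {y} e = Semiframe.antisym X
        (reflects-≤ x y (≐⇒⊆ {U = Op X x} {V = Op X y} e))
        (reflects-≤ y x (≐⇒⊆ {U = Op X y} {V = Op X x} (λ F → sym (e F))))

      Op⁻¹ : Func StX.setoid setoid
      Op⁻¹ = record
        { to   = λ U → proj₁ (index U)
        ; cong = λ {U} {V} U≐V → Op-injective λ F →
            trans (sym (proj₂ (index U) F)) (trans (U≐V F) (proj₂ (index V) F))
        }

      Op∘Op⁻¹ : ∀ U → Op X (to Op⁻¹ U) ≐ proj₁ U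
      Op∘Op⁻¹ U F = sym (proj₂ (index U) F)

      -- The two families have the same members up to `≐`. This lets the join law for `Op⁻¹` be read
      -- off from the one for `Op`.
      ⋁-image-Op∘Op⁻¹ : ∀ 𝒴 → proj₁ (StX.⋁ 𝒴) ≐ proj₁ (StX.⋁ (image Op-func (image Op⁻¹ 𝒴)))
      ⋁-image-Op∘Op⁻¹ 𝒴 = StX.antisym {StX.⋁ 𝒴} {StX.⋁ (image Op-func (image Op⁻¹ 𝒴))}
        (⋁-mono (Fr₀ (St₀ X)) 𝒴 (image Op-func (image Op⁻¹ 𝒴)) λ U U∈𝒴 →
           U , fromWitness (to Op⁻¹ U , fromWitness (U , U∈𝒴 , Semiframe.Eq.refl X) , proj₂ (index U)) , λ _ F∈U → F∈U)
        (⋁-mono (Fr₀ (St₀ X)) (image Op-func (image Op⁻¹ 𝒴)) 𝒴 λ V V∈ →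
           let (x , x∈ , V≐Opx)     = toWitness V∈
               (U , U∈𝒴 , x≈Op⁻¹U) = toWitness x∈
           in U , U∈𝒴 , λ F@(F′ , _) F∈V →
                subst T (trans (V≐Opx F) (trans (cong F′ x≈Op⁻¹U) (Op∘Op⁻¹ U F))) F∈V)

      -- Equations in `X` are checked after applying `Op`, so both preservation laws reduce to those
      -- of `Op`; reflection of `∗` is the spatiality condition `∗⇒≬`.
      Op⁻¹-morphism : SemiframeMorphism (Fr₀ (St₀ X)) X
      Op⁻¹-morphism = record
        { map         = Op⁻¹
        ; preserves-⋁ = λ 𝒴 → Op-injective λ F →
            trans (Op∘Op⁻¹ (StX.⋁ 𝒴) F)
              (trans (⋁-image-Op∘Op⁻¹ 𝒴 F) (sym (Op-preserves-⋁ (image Op⁻¹ 𝒴) F)))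
        ; preserves-⊤ = Op-injective λ F → trans (Op∘Op⁻¹ StX.⊤ₓ F) (sym (Op-preserves-⊤ F))
        ; reflects-∗  = λ U V x∗y → let (F , x∈F , y∈F) = ∗⇒≬ _ _ x∗y in
            F , subst T (Op∘Op⁻¹ U F) x∈F , subst T (Op∘Op⁻¹ V F) y∈F
        }

    -- The underlying subset is the one that `St₁` of `Op-morphism` would give; it serves as the
    -- preimage of `𝔽` under `nbhd`.
    pullback-Op : Setoid.Carrier (Points (Fr₀ (St₀ X))) → Setoid.Carrier (Points X)
    pullback-Op (𝔽 , pt) = preimage Op-func 𝔽 , record
      { nonempty         = let (U , U∈𝔽) = nonempty ; (x , U≐Opx) = index U in
          x , ∈-resp 𝔽 {U} {Op-open x} U≐Opx U∈𝔽
      ; up-closed        = λ x y x∈ x≤y → up-closed (Op-open x) (Op-open y) x∈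
          λ (_ , ptF) x∈F → IsAbstractPoint.up-closed ptF x y x∈F x≤y
      ; compatible       = λ x y x∈ y∈ → SemiframeMorphism.reflects-∗ Op-morphism x y
          (compatible (Op-open x) (Op-open y) x∈ y∈)
      ; completely-prime = λ Y ⋁Y∈ →
          let (U , U∈ , U∈𝔽)    = completely-prime (image Op-func Y)
                (up-closed (Op-open (⋁ Y)) _ ⋁Y∈
                   λ F → subst T (Op-preserves-⋁ Y F))
              (y , y∈Y , U≐Opy) = toWitness U∈
          in y , y∈Y , ∈-resp 𝔽 {U} {Op-open y} U≐Opy U∈𝔽
      }
      where open IsAbstractPoint pt

    St-sober : IsSober (St₀ X)
    St-sober =
        (λ nbhdF≐nbhdG x → nbhdF≐nbhdG (Op-open x))
      -- Every open is some `Op x`, so agreement with `𝔽` need only be checked there, where it holds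
      -- by definition of the pullback.
      , λ 𝔽 → pullback-Op 𝔽 , λ {F} F≐ U → let (x , U≐Opx) = index U in
          trans (U≐Opx F) (trans (F≐ x) (sym (cong (proj₁ 𝔽) {U} {Op-open x} U≐Opx)))

  -- The action of `St` on semiframe morphisms.

  St₁ : ∀ {X′ X} → SemiframeMorphism X′ X → ContinuousMap (St₀ X) (St₀ X′)
  St₁ {X′} {X} g = record
    { map        = record
        { to   = λ (F , pt) → preimage g.map F , pullback F pt
        ; cong = λ F≐G x′ → F≐G (to g.map x′)
        }
    -- The preimage of `Op x′` is `Op (g x′)`.
    ; continuous = λ U U∈ → let (x′ , U≐Opx′) = index X′ (U , U∈) in
        fromWitness (to g.map x′ , λ (F , pt) → U≐Opx′ (preimage g.map F , pullback F pt))
    }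
    where
    module g = SemiframeMorphism g
    module X = Semiframe X
    module X′ = Semiframe X′

    pullback : ∀ F → IsAbstractPoint X F → IsAbstractPoint X′ (preimage g.map F)
    pullback F pt = record
      -- The top element is the witness: `F` contains `X.⊤ₓ` by up-closure, and `g` preserves the
      -- top.
      { nonempty         = let (x , x∈F) = nonempty in X′.⊤ₓ ,
          ∈-resp F (X.Eq.sym g.preserves-⊤) (up-closed x X.⊤ₓ x∈F (X.⋁-upper (full X.setoid) x _))
      ; up-closed        = λ x y gx∈F x≤y → up-closed (to g.map x) (to g.map y) gx∈F (monotone x y x≤y)
      ; compatible       = λ x y gx∈F gy∈F → g.reflects-∗ x y (compatible _ _ gx∈F gy∈F)
      ; completely-prime = prime
      }
      where
      open IsAbstractPoint pt

      prime : ∀ Y → X′.⋁ Y ∈ preimage g.map F → ∃[ y ] (y ∈ Y × y ∈ preimage g.map F)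
      prime Y g⋁∈F =
        let (z , z∈ , z∈F)   = completely-prime (image g.map Y) (∈-resp F (g.preserves-⋁ Y) g⋁∈F)
            (y , y∈Y , z≈gy) = toWitness z∈
        in y , y∈Y , ∈-resp F z≈gy z∈F

      -- x ≤ y makes y the join of ↓y ∋ x, and g preserves that join.
      monotone : ∀ x y → x X′.≤ y → to g.map x X.≤ to g.map y
      monotone x y x≤y = X.trans
        (X.⋁-upper (image g.map ↓y) (to g.map x) (fromWitness (x , fromWitness x≤y , X.Eq.refl)))
        (X.reflexive (X.Eq.trans (X.Eq.sym (g.preserves-⋁ ↓y)) (cong g.map ⋁↓y≈y)))
        where
        ↓y : Subset X′.setoid
        ↓y = compr X′.setoid (X′._≤ y) (λ a≈b → X′.trans (X′.reflexive (X′.Eq.sym a≈b)))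

        ⋁↓y≈y : X′.⋁ ↓y X′.≈ y
        ⋁↓y≈y = X′.antisym (X′.⋁-least ↓y y (λ _ → toWitness)) (X′.⋁-upper ↓y y (fromWitness X′.refl))

  -- The map `nbhd` and its continuous inverse in the sober case.

  nbhd-func : ∀ S → Func (points S) (Points (Fr₀ S))
  nbhd-func S = record { to = nbhd S ; cong = λ p≈q (O , _) → cong O p≈q }

  nbhd-continuous : ∀ S → ContinuousMap S (St₀ (Fr₀ S))
  nbhd-continuous S = record
    { map        = nbhd-func S
    -- The preimage of `Op O` under `nbhd` is `O` itself.
    ; continuous = λ U U∈ → let ((O , O∈𝒪) , U≐OpO) = index (Fr₀ S) (U , U∈) in
        ∈-resp (𝒪 S) {O} {preimage (nbhd-func S) U} (λ p → sym (U≐OpO (nbhd S p))) O∈𝒪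
    }

  module _ (S : Semitopology) (sober : IsSober S) where
    private
      module P = Setoid (points S)
      module ℙ = Setoid (Points (Fr₀ S))

    nbhd⁻¹ : ℙ.Carrier → P.Carrier
    nbhd⁻¹ F = proj₁ (proj₂ sober F)

    nbhd∘nbhd⁻¹ : ∀ F → nbhd S (nbhd⁻¹ F) ℙ.≈ F
    nbhd∘nbhd⁻¹ F = proj₂ (proj₂ sober F) P.refl

    -- Since `nbhd (nbhd⁻¹ F)` equals `F`, the point `nbhd⁻¹ F` lies in `O` exactly when `O` lies in
    -- `F`, so the preimage of `O` is `Op O`.
    nbhd⁻¹-continuous : ContinuousMap (St₀ (Fr₀ S)) S
    nbhd⁻¹-continuous = record
      { map        = record
          { to   = nbhd⁻¹
          ; cong = λ {F} {G} F≐G → proj₁ sober λ O →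
              trans (nbhd∘nbhd⁻¹ F O) (trans (F≐G O) (sym (nbhd∘nbhd⁻¹ G O)))
          }
      ; continuous = λ O O∈𝒪 → fromWitness ((O , O∈𝒪) , λ F → nbhd∘nbhd⁻¹ F (O , O∈𝒪))
      }

  -- The functors and the two natural isomorphisms.

  Fr : Functor Sober (Spatial ᵒᵖ) (λ (S , _) → Fr₀ S , Fr-spatial S)
  Fr = record
    { F₁           = λ {(S , _)} {(S′ , _)} → Fr₁ {S} {S′}
    ; F-resp-≈     = λ f≈g (O , _) p → cong O (f≈g p)
    ; identity     = λ _ _ → refl
    ; homomorphism = λ _ _ → refl
    }

  St : Functor (Spatial ᵒᵖ) Sober (λ (X , _) → St₀ X , St-sober X)
  St = record
    { F₁           = λ {(X , _)} {(X′ , _)} → St₁ {X′} {X}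
    ; F-resp-≈     = λ f≈g (F , _) x → cong F (f≈g x)
    ; identity     = λ _ _ → refl
    ; homomorphism = λ _ _ → refl
    }

  nbhd-iso : NaturalIsomorphism idF (St ∘F Fr)
  nbhd-iso = record
    { component = λ (S , _) → nbhd-continuous S
    ; inverse   = λ (S , sober) → nbhd⁻¹-continuous S sober
    ; isoˡ      = λ (S , sober) p → proj₁ sober (nbhd∘nbhd⁻¹ S sober (nbhd S p))
    ; isoʳ      = λ (S , sober) → nbhd∘nbhd⁻¹ S sober
    ; natural   = λ _ _ _ → refl
    }

  Op-iso : NaturalIsomorphism (Fr ∘F St) idF
  Op-iso = record
    { component = λ (X , _) → Op-morphism X
    ; inverse   = λ (X , spatial) → Op⁻¹-morphism X spatial
    -- Composition in `Spatial ᵒᵖ` is reversed, so the left law concerns `Op` after `Op⁻¹`, and the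
    -- right law `Op⁻¹` after `Op`.
    ; isoˡ      = λ (X , spatial) → Op∘Op⁻¹ X spatial
    ; isoʳ      = λ (X , spatial) x → Op-injective X spatial (Op∘Op⁻¹ X spatial (Op-open X x))
    ; natural   = λ _ _ _ → refl
    }

  -- Comparing types across two instantiations of Semi lem is expensive, so the
  -- result is assembled under a single one and converted once at the end.
  duality :
    let open NaturalIsomorphism
        open CategoryEquivalence
    in
    Σ[ Fr-spatial ∈ (∀ S → IsSober S → IsSpatial (Fr₀ S)) ]
    Σ[ St-sober ∈ (∀ X → IsSpatial X → IsSober (St₀ X)) ]
    Σ[ Fr ∈ Functor Sober (Spatial ᵒᵖ) (λ (S , sob) → Fr₀ S , Fr-spatial S sob) ]
    Σ[ St ∈ Functor (Spatial ᵒᵖ) Sober (λ (X , spa) → St₀ X , St-sober X spa) ]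
    Σ[ equivalence ∈ CategoryEquivalence Fr St ]
      (∀ (A B : Category.Obj Sober) (f : ContinuousMap (proj₁ A) (proj₁ B)) (O : Semitopology.Open (proj₁ B)) →
         proj₁ (Func.to (SemiframeMorphism.map (Functor.F₁ Fr {A} {B} f)) O)
           ≐ preimage (ContinuousMap.map f) (proj₁ O))
    × (∀ (A′ A : Category.Obj Spatial) (g : SemiframeMorphism (proj₁ A′) (proj₁ A)) (F : Setoid.Carrier (Points (proj₁ A))) →
         proj₁ (Func.to (ContinuousMap.map (Functor.F₁ St {A} {A′} g)) F)
           ≐ preimage (SemiframeMorphism.map g) (proj₁ F))
    × (∀ (A : Category.Obj Sober) (p : Setoid.Carrier (Semitopology.points (proj₁ A))) →
         proj₁ (Func.to (ContinuousMap.map (component (unit equivalence) A)) p)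
           ≐ proj₁ (nbhd (proj₁ A) p))
    × (∀ (A : Category.Obj Spatial) (x : Semiframe.Carrier (proj₁ A)) →
         proj₁ (Func.to (SemiframeMorphism.map (component (counit equivalence) A)) x)
           ≐ Op (proj₁ A) x)
  duality =
      (λ S _ → Fr-spatial S)
    , (λ X _ → St-sober X)
    , Fr
    , St
    , record { unit = nbhd-iso ; counit = Op-iso }
    , (λ _ _ _ _ _ → refl)
    , (λ _ _ _ _ _ → refl)
    , (λ _ _ _ → refl)
    , (λ _ _ _ → refl)

theorem8p18 : ∀ {ℓ : Level} (lem : ExcludedMiddle ℓ) →
  let open Semi lem
      open NaturalIsomorphism
      open CategoryEquivalence
  in
  Σ[ Fr-spatial ∈ (∀ S → IsSober S → IsSpatial (Fr₀ S)) ]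
  Σ[ St-sober ∈ (∀ X → IsSpatial X → IsSober (St₀ X)) ]
  Σ[ Fr ∈ Functor Sober (Spatial ᵒᵖ) (λ (S , sob) → Fr₀ S , Fr-spatial S sob) ]
  Σ[ St ∈ Functor (Spatial ᵒᵖ) Sober (λ (X , spa) → St₀ X , St-sober X spa) ]
  Σ[ equivalence ∈ CategoryEquivalence Fr St ]
    (∀ (A B : Category.Obj Sober) (f : ContinuousMap (proj₁ A) (proj₁ B)) (O : Semitopology.Open (proj₁ B)) →
       proj₁ (Func.to (SemiframeMorphism.map (Functor.F₁ Fr {A} {B} f)) O)
         ≐ preimage (ContinuousMap.map f) (proj₁ O))
  × (∀ (A′ A : Category.Obj Spatial) (g : SemiframeMorphism (proj₁ A′) (proj₁ A)) (F : Setoid.Carrier (Points (proj₁ A))) →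
       proj₁ (Func.to (ContinuousMap.map (Functor.F₁ St {A} {A′} g)) F)
         ≐ preimage (SemiframeMorphism.map g) (proj₁ F))
  × (∀ (A : Category.Obj Sober) (p : Setoid.Carrier (Semitopology.points (proj₁ A))) →
       proj₁ (Func.to (ContinuousMap.map (component (unit equivalence) A)) p)
         ≐ proj₁ (nbhd (proj₁ A) p))
  × (∀ (A : Category.Obj Spatial) (x : Semiframe.Carrier (proj₁ A)) →
       proj₁ (Func.to (SemiframeMorphism.map (component (counit equivalence) A)) x)
         ≐ Op (proj₁ A) x)
theorem8p18 = duality
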